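{- Let $\lambda,\mu$ be $k$-bounded partitions. Then $\lambda\to_k\mu$ if and only if $\lambda=\mu-e_r$ for some row $r$ such that $\mathfrak{c}(\mu)$ has a removable corner in row $r$ whose residue $i$ is not the residue of any removable corner of $\mathfrak{c}(\mu)$ lying in a higher row; in this case $s_i(\mathfrak{c}(\mu))=\mathfrak{c}(\lambda)$. Equivalently, $\lambda\to_k\mu$ if and only if $\mu=\lambda+e_r$ for some row $r$ such that $\mathfrak{c}(\lambda)$ has an addable corner in row $r$ whose residue is not the residue of any addable corner of $\mathfrak{c}(\lambda)$ in a higher row.
   Context: Fix $k\ge1$. Partitions are Ferrers diagrams in French convention: cells $(i,j)$, $1\le j\le\lambda_i$, $i$ the row (row 1 at the bottom), $j$ the column. The hook length of a cell $s=(i,j)$ of $\gamma$ is the number of cells $(i,j')\in\gamma$ with $j'\ge j$ plus the number of cells $(i',j)\in\gamma$ with $i'>i$; a cell is $k$-bounded if its hook length is at most $k$. A $(k+1)$-core is a partition with no cell of hook length $k+1$; $\mathcal{C}_{k+1}$ is the set of $(k+1)$-cores and $\mathcal{P}_k$ the set of $k$-bounded partitions (largest part at most $k$). The map $\mathfrak{p}:\mathcal{C}_{k+1}\to\mathcal{P}_k$, $\mathfrak{p}(\gamma)_i=$ number of $k$-bounded cells in row $i$ of $\gamma$, is a bijection; $\mathfrak{c}$ denotes its inverse. The $k$-conjugate of $\lambda\in\mathcal{P}_k$ is $\lambda^{\omega_k}=\mathfrak{p}(\mathfrak{c}(\lambda)')$, where $'$ denotes conjugation of partitions. For $\lambda,\mu\in\mathcal{P}_k$,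 $\lambda\to_k\mu$ means $|\mu|=|\lambda|+1$, $\lambda\subseteq\mu$ and $\lambda^{\omega_k}\subseteq\mu^{\omega_k}$. $e_r$ is the $r$-th unit vector. The residue of a square $(i,j)$ is $j-i\bmod(k+1)$. A removable corner of $\gamma$ is a cell $(i,j)\in\gamma$ with $(i,j+1),(i+1,j)\notin\gamma$; an addable corner is a square $(i,j)\notin\gamma$ with $(i,j-1),(i-1,j)\in\gamma$ (squares in row 0 or column 0 count as in $\gamma$). For a $(k+1)$-core $\gamma$ and $i\in\{0,\ldots,k\}$, $s_i(\gamma)$ is obtained by removing all removable corners of residue $i$ if there is one, by adding all addable corners of residue $i$ if there is one, and $s_i(\gamma)=\gamma$ otherwise. -}

module Defs where

open import Data.Nat using (ℕ; zero; suc; _+_; _*_; _∸_; _≤_; _<_; _≤ᵇ_; _≡ᵇ_)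
open import Data.Nat.DivMod using (_%_)
open import Data.Bool using (Bool; true; false; _∧_; _∨_; if_then_else_)
open import Data.List using (List; []; _∷_; length; map; upTo; filter)
open import Data.Nat.ListAction using (sum)
open import Data.Bool.ListAction using (any)
open import Data.Nat.Properties using (_≤?_)
open import Data.Product using (_×_; Σ; ∃)
open import Data.Sum using (_⊎_)
open import Relation.Nullary using (¬_)
open import Relation.Binary.PropositionalEquality using (_≡_; _≢_)

-- A partition is a list of its (positive) parts, weakly decreasing,
-- listed from row 1 (bottom row, French convention) upwards.

-- row γ i : length of row i (rows are 1-indexed); 0 for i = 0 or i > length γ.
at : List ℕ → ℕ → ℕ
at []       _       = 0
at (x ∷ xs) zero    = x
at (x ∷ xs) (suc n) = at xs n

row : List ℕ → ℕ → ℕ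
row γ zero    = 0
row γ (suc i) = at γ i

data IsPartition : List ℕ → Set where
  nil  : IsPartition []
  one  : ∀ {x} → 1 ≤ x → IsPartition (x ∷ [])
  cons : ∀ {x y ys} → y ≤ x → IsPartition (y ∷ ys) → IsPartition (x ∷ y ∷ ys)

from_count_ : ℕ → ℕ → List ℕ
from a count n = map (λ t → suc (a + t)) (upTo n)

rows : List ℕ → List ℕ
rows γ = from 0 count (length γ)

leg : List ℕ → ℕ → ℕ → ℕ
leg γ i j = length (filter (λ i' → j ≤? row γ i') (from i count (length γ ∸ i)))

hook : List ℕ → ℕ → ℕ → ℕ
hook γ i j = (row γ i ∸ j + 1) + leg γ i j

IsCell : List ℕ → ℕ → ℕ → Set
IsCell γ i j = 1 ≤ i × 1 ≤ j × j ≤ row γ i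

IsCore : ℕ → List ℕ → Set
IsCore k γ = IsPartition γ × (∀ i j → IsCell γ i j → hook γ i j ≢ suc k)

𝔭 : ℕ → List ℕ → List ℕ
𝔭 k γ = map (λ i → length (filter (λ j → hook γ i j ≤? k) (from 0 count (row γ i)))) (rows γ)

conj : List ℕ → List ℕ
conj γ = map (λ j → length (filter (λ i → j ≤? row γ i) (rows γ))) (from 0 count (row γ 1))

∣_∣ : List ℕ → ℕ
∣ γ ∣ = sum γ

_⊆_ : List ℕ → List ℕ → Set
λ' ⊆ μ = ∀ i → row λ' i ≤ row μ i

δ : ℕ → ℕ → ℕ
δ i r = if i ≡ᵇ r then 1 else 0

_≐_-e_ : List ℕ → List ℕ → ℕ → Set
λ' ≐ μ -e r = ∀ i → row λ' i + δ i r ≡ row μ i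

_≐_+e_ : List ℕ → List ℕ → ℕ → Set
μ ≐ λ' +e r = ∀ i → row μ i ≡ row λ' i + δ i r

-- same partition (equal row lengths, ignoring trailing zero parts)
_≅_ : List ℕ → List ℕ → Set
γ ≅ γ' = ∀ i → row γ i ≡ row γ' i

-- residue of the square (i,j): (j - i) mod (k+1), computed as (j + k*i) mod (k+1)
res : ℕ → ℕ → ℕ → ℕ
res k i j = (j + k * i) % suc k

RemCorner : List ℕ → ℕ → Set
RemCorner γ r = 1 ≤ r × 1 ≤ row γ r × row γ (suc r) < row γ r

remRes : ℕ → List ℕ → ℕ → ℕ
remRes k γ r = res k r (row γ r)

AddCorner : List ℕ → ℕ → Set
AddCorner γ r = 1 ≤ r × (r ≡ 1 ⊎ suc (row γ r) ≤ row γ (r ∸ 1))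

addRes : ℕ → List ℕ → ℕ → ℕ
addRes k γ r = res k r (suc (row γ r))

remB : List ℕ → ℕ → Bool
remB γ r = (1 ≤ᵇ row γ r) ∧ (suc (row γ (suc r)) ≤ᵇ row γ r)

addB : List ℕ → ℕ → Bool
addB γ r = (r ≡ᵇ 1) ∨ (suc (row γ r) ≤ᵇ row γ (r ∸ 1))

remI : ℕ → ℕ → List ℕ → ℕ → Bool
remI k i γ r = remB γ r ∧ (remRes k γ r ≡ᵇ i)

addI : ℕ → ℕ → List ℕ → ℕ → Bool
addI k i γ r = addB γ r ∧ (addRes k γ r ≡ᵇ i)

s : ℕ → ℕ → List ℕ → List ℕ
s k i γ =
  if any (remI k i γ) (rows γ)
  then map (λ r → if remI k i γ r then row γ r ∸ 1 else row γ r) (rows γ)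
  else (if any (addI k i γ) (from 0 count (suc (length γ)))
        then map (λ r → if addI k i γ r then suc (row γ r) else row γ r) (from 0 count (suc (length γ)))
        else γ)

-- k-conjugate of 𝔭 γ, i.e. 𝔭(𝔠(𝔭 γ)') = 𝔭(γ') for a core γ
kconj : ℕ → List ℕ → List ℕ
kconj k γ = 𝔭 k (conj γ)

-- 𝔭 δ →_k 𝔭 γ, for (k+1)-cores δ = 𝔠(λ), γ = 𝔠(μ)
Arrow : ℕ → List ℕ → List ℕ → Set
Arrow k δ' γ = (∣ 𝔭 k γ ∣ ≡ suc ∣ 𝔭 k δ' ∣) × (𝔭 k δ' ⊆ 𝔭 k γ) × (kconj k δ' ⊆ kconj k γ)

{-# OPTIONS --safe #-}
module Submission where

-- In a (k+1)-core γ with p = 𝔭 γ one has γ_i = p_i + γ_{n(i)} with n(i) = i + k + 1 − p_i, and n(i) is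
-- the first row above i whose last cell has the same residue. The recursion determines γ from p
-- downwards. If 𝔭 δ = 𝔭 γ − e_r, then δ and γ agree above row r and
-- δ_r = γ_r − 1 − (γ_{n(r)} − γ_{n(r)+1}), so everything depends on whether rows n(r) and n(r) + 1 of γ
-- are equal. If they are, then among the rows ending in the residue of r exactly those up to r are
-- removable, and δ arises from γ by shortening each of these by one cell; the column lengths then
-- interlace, which gives the containment of k-conjugates. If they are not, some cell of row r is
-- k-bounded in δ but not in γ, in a column of the same height in both, and containment fails.

open import Defs
open import Data.Bool using (Bool; true; false; T; if_then_else_)
open import Data.Bool.ListAction using (any)
open import Data.Bool.Properties using (T-∧)
open import Data.List using (List; []; _∷_; length; map; upTo; applyUpTo; filter)
open import Data.List.Properties using (map-upTo; map-applyUpTo)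
open import Data.Nat hiding (∣_-_∣)
open import Data.Nat.DivMod
open import Data.Nat.ListAction using (sum)
open import Data.Nat.Properties
open import Data.Nat.Tactic.RingSolver using (solve-∀)
open import Data.Product using (_×_; _,_; ∃; proj₁; proj₂)
open import Data.Sum using (_⊎_; inj₁; inj₂)
open import Function using (_∘_)
open import Function.Bundles using (_⇔_; mk⇔; Equivalence)
open import Relation.Nullary using (¬_; yes; no; contradiction)
open import Relation.Unary using (Decidable)
open import Relation.Binary.Definitions using (tri<; tri≈; tri>)
open import Relation.Binary.PropositionalEquality

-- One core: the row recursion and the rows sharing a residue

-- Adding `a * k` completes `a` to a multiple of `suc k`, which replaces subtraction of `a` modulo
-- `suc k`.
+-%-cancel : ∀ k a t → t < suc k → (a + t) % suc k ≡ a % suc k → t ≡ 0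
+-%-cancel k a t t<n eq = begin
  t                                              ≡⟨ m<n⇒m%n≡m t<n ⟨
  t % suc k                                      ≡⟨ [m+kn]%n≡m%n t a (suc k) ⟨
  (t + a * suc k) % suc k                        ≡⟨ %-congˡ {o = suc k} (regroup a t k) ⟩
  (a * k + (a + t)) % suc k                      ≡⟨ %-distribˡ-+ (a * k) (a + t) (suc k) ⟩
  ((a * k) % suc k + (a + t) % suc k) % suc k    ≡⟨ cong (λ x → ((a * k) % suc k + x) % suc k) eq ⟩
  ((a * k) % suc k + a % suc k) % suc k          ≡⟨ %-distribˡ-+ (a * k) a (suc k) ⟨
  (a * k + a) % suc k                            ≡⟨ %-congˡ {o = suc k} (trans (+-comm (a * k) a) (sym (*-suc a k))) ⟩
  (a * suc k) % suc k                            ≡⟨ m*n%n≡0 a (suc k) ⟩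
  0                                              ∎
  where
  open ≡-Reasoning
  regroup : ∀ a t k → t + a * suc k ≡ a * k + (a + t)
  regroup = solve-∀

-- f, g and p are the row lengths, the column lengths and the parts of 𝔭, all indexed from 0. The cell
-- in row i and column c has hook length f i + g c − (i + c + 1); the fields state this without
-- subtraction.
record CoreRows (k : ℕ) (f g p : ℕ → ℕ) : Set where
  field
    cell→    : ∀ {i c} → c < f i → i < g c
    cell←    : ∀ {i c} → i < g c → c < f i
    noHook   : ∀ {i c} → c < f i → f i + g c ≢ suc k + suc (i + c)
    bounded→ : ∀ {i c} → c < f i → f i + g c ≤ k + suc (i + c) → f i ≤ p i + c
    bounded← : ∀ {i c} → c < f i → f i ≤ p i + c → f i + g c ≤ k + suc (i + c)
    p≤f      : ∀ i → p i ≤ f i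

module Rows {k f g p} (C : CoreRows k f g p) where
  open CoreRows C public

  antitone : ∀ {i j} → i ≤ j → f j ≤ f i
  antitone i≤j = ≮⇒≥ λ lt → <-irrefl refl (cell← (≤-<-trans i≤j (cell→ lt)))

  vanishes : ∀ {i} → g 0 ≤ i → f i ≡ 0
  vanishes h = n≤0⇒n≡0 (≮⇒≥ λ 0<f → <⇒≱ (cell→ 0<f) h)

  next : ℕ → ℕ
  next i = suc (i + (k ∸ p i))

  i<next : ∀ i → i < next i
  i<next i = s≤s (m≤m+n i _)

  -- The hook of the first `k`-bounded cell of the row contains all `p i` bounded cells of the row,
  -- and its length is at most `k`.
  p≤k : ∀ i → p i ≤ k
  p≤k i with p i ≟ 0
  ... | yes p≡0 = subst (_≤ k) (sym p≡0) z≤n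
  ... | no  p≢0 = +-cancelˡ-≤ (suc (i + c)) (p i) k (begin
    suc (i + c) + p i    ≡⟨ regroup i c (p i) ⟩
    (p i + c) + suc i    ≡⟨ cong (_+ suc i) (m+[n∸m]≡n (p≤f i)) ⟩
    f i + suc i          ≤⟨ +-monoʳ-≤ (f i) (cell→ c<f) ⟩
    f i + g c            ≤⟨ bounded← c<f (≤-reflexive (sym (m+[n∸m]≡n (p≤f i)))) ⟩
    k + suc (i + c)      ≡⟨ +-comm k _ ⟩
    suc (i + c) + k      ∎)
    where
    open ≤-Reasoning
    c = f i ∸ p i
    c<f : c < f i
    c<f = ∸-monoʳ-< {o = 0} (n≢0⇒n>0 p≢0) (p≤f i)
    regroup : ∀ i c p → suc (i + c) + p ≡ p + c + suc i
    regroup = solve-∀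

  k-split : ∀ i → p i + (k ∸ p i) ≡ k
  k-split i = m+[n∸m]≡n (p≤k i)

  -- The cell of row `i` in column `f i ∸ p i`, if there is one, is `k`-bounded, so its column ends
  -- before row `next i`.
  f-next≤ : ∀ i → f (next i) ≤ f i ∸ p i
  f-next≤ i = ≮⇒≥ λ c<f-next →
    <⇒≱ (cell→ c<f-next) (+-cancelˡ-≤ (p i + c) (g c) (next i) (begin
      (p i + c) + g c              ≡⟨ cong (_+ g c) f≡ ⟩
      f i + g c                    ≤⟨ bounded← (<-≤-trans c<f-next (antitone (<⇒≤ (i<next i)))) (≤-reflexive (sym f≡)) ⟩
      k + suc (i + c)              ≡⟨ cong (_+ suc (i + c)) (k-split i) ⟨
      p i + (k ∸ p i) + suc (i + c) ≡⟨ regroup (p i) (k ∸ p i) i c ⟩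
      (p i + c) + next i           ∎))
    where
    open ≤-Reasoning
    c = f i ∸ p i
    f≡ : p i + c ≡ f i
    f≡ = m+[n∸m]≡n (p≤f i)
    regroup : ∀ p m i c → p + m + suc (i + c) ≡ p + c + suc (i + m)
    regroup = solve-∀

  -- The last unbounded cell of row `i` has hook length at least `k + 2`, as the core condition
  -- excludes `k + 1`; hence its column reaches row `next i`.
  f-next≥ : ∀ i c → p i + c ≡ f i → c ≤ f (next i)
  f-next≥ i zero    _  = z≤n
  f-next≥ i (suc c) f≡ = cell← (+-cancelˡ-≤ (p i + suc c) (suc (next i)) (g c) (begin
    p i + suc c + suc (next i)                ≡⟨ regroup (p i) (k ∸ p i) i c ⟩
    suc (suc (p i + (k ∸ p i)) + suc (i + c)) ≡⟨ cong (λ x → suc (suc x + suc (i + c))) (k-split i) ⟩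
    suc (suc k + suc (i + c))                 ≤⟨ ≤∧≢⇒< (≰⇒> (f≰ ∘ bounded→ c<f)) (≢-sym (noHook c<f)) ⟩
    f i + g c                                 ≡⟨ cong (_+ g c) f≡ ⟨
    p i + suc c + g c                         ∎))
    where
    open ≤-Reasoning
    c<f : c < f i
    c<f = subst (c <_) f≡ (m≤n+m (suc c) (p i))
    f≰ : ¬ f i ≤ p i + c
    f≰ h = <⇒≱ (subst (p i + c <_) f≡ (+-monoʳ-< (p i) ≤-refl)) h
    regroup : ∀ p m i c → p + suc c + suc (suc (i + m)) ≡ suc (suc (p + m) + suc (i + c))
    regroup = solve-∀

  -- The k-bounded cells of row i are its last p i cells; without them the row is as long as row
  -- next i, which is therefore the next row ending in the same residue.
  recursion : ∀ i → f i ≡ p i + f (next i)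
  recursion i = trans (sym f≡) (cong (p i +_) (≤-antisym (f-next≥ i _ f≡) (f-next≤ i)))
    where f≡ = m+[n∸m]≡n (p≤f i)

  next-order : ∀ {i j} → next i ≤ next j → p j < p i → f j < f i
  next-order {i} {j} ni≤nj pj<pi = begin-strict
    f j               ≡⟨ recursion j ⟩
    p j + f (next j)  <⟨ +-mono-<-≤ pj<pi (antitone ni≤nj) ⟩
    p i + f (next i)  ≡⟨ recursion i ⟨
    f i               ∎
    where open ≤-Reasoning

  -- If `p (suc i)` were larger, `next (suc i)` would be at most `next i`, and the recursion would
  -- make row `suc i` longer than row `i`.
  p-antitone : ∀ i → p (suc i) ≤ p i
  p-antitone i = ≮⇒≥ λ lt → <⇒≱
    (next-order {suc i} {i} (s≤s (≤-trans (≤-reflexive (sym (+-suc i _))) (+-monoʳ-≤ i (∸-monoʳ-< lt (p≤k (suc i)))))) lt)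
    (antitone (n≤1+n i))

  p-flat : ∀ {i} → f i ≡ f (suc i) → p (suc i) ≡ p i
  p-flat {i} flat = ≤-antisym (p-antitone i) (≮⇒≥ λ lt →
    <-irrefl (sym flat) (next-order {i} {suc i} (s≤s (+-mono-≤ (n≤1+n i) (∸-monoʳ-≤ k (<⇒≤ lt)))) lt))

  next-flat : ∀ {i} → f i ≡ f (suc i) → next (suc i) ≡ suc (next i)
  next-flat {i} flat = cong (λ x → suc (suc (i + (k ∸ x)))) (p-flat flat)

  -- Equality of adjacent rows is thus passed upwards along `next`. Within one residue, the rows
  -- with a removable corner therefore lie below those without.
  flat-next : ∀ {i} → f i ≡ f (suc i) → f (next i) ≡ f (suc (next i))
  flat-next {i} flat = +-cancelˡ-≡ (p i) _ _ (begin
    p i + f (next i)             ≡⟨ recursion i ⟨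
    f i                          ≡⟨ flat ⟩
    f (suc i)                    ≡⟨ recursion (suc i) ⟩
    p (suc i) + f (next (suc i)) ≡⟨ cong₂ (λ x y → x + f y) (p-flat flat) (next-flat flat) ⟩
    p i + f (suc (next i))       ∎)
    where open ≡-Reasoning

  -- Residue of the last cell of row i for e = 0, and of the square to the right of it for e = 1.
  residue : ℕ → ℕ → ℕ
  residue e i = (e + f i + k * suc i) % suc k

  -- From row `i` to row `next i` the last cell moves `p i` columns to the left and `suc (k ∸ p i)`
  -- rows up, so its content drops by exactly `k + 1`.
  residue-next : ∀ e i → residue e (next i) ≡ residue e i
  residue-next e i = begin
    (e + f (next i) + k * suc (next i)) % suc k                ≡⟨ [m+kn]%n≡m%n (e + f (next i) + k * suc (next i)) (p i) (suc k) ⟨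
    (e + f (next i) + k * suc (next i) + p i * suc k) % suc k  ≡⟨ %-congˡ {o = suc k} shift ⟩
    (e + f i + k * suc i + k * suc k) % suc k                  ≡⟨ [m+kn]%n≡m%n (e + f i + k * suc i) k (suc k) ⟩
    (e + f i + k * suc i) % suc k                              ∎
    where
    open ≡-Reasoning
    regroup : ∀ k p m e x i → e + x + k * suc (suc (i + m)) + p * suc k ≡ e + (p + x) + k * suc i + k * suc (p + m)
    regroup = solve-∀
    shift : e + f (next i) + k * suc (next i) + p i * suc k ≡ e + f i + k * suc i + k * suc k
    shift = trans (regroup k (p i) (k ∸ p i) e (f (next i)) i)
      (cong₂ (λ x y → e + x + k * suc i + k * suc y) (sym (recursion i)) (k-split i))

  -- For i < r < next i the contents of the last cells of rows i and r differ by at least 1 and at most k.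
  next-first : ∀ e {i r} → i < r → residue e i ≡ residue e r → next i ≤ r
  next-first e {i} {r} i<r res≡ = ≮⇒≥ λ r<next → contra (s≤s⁻¹ r<next)
    where
    contra : ¬ r ≤ i + (k ∸ p i)
    -- The contents differ by `suc (v + d)`: `v` columns and `suc d` rows.
    contra r≤ = 1+n≢0 (+-%-cancel k (e + f r + k * suc r) (suc (v + d)) (s≤s t≤) (begin
      (e + f r + k * suc r + suc (v + d)) % suc k        ≡⟨ %-congˡ {o = suc k} shift ⟩
      (e + f i + k * suc i + suc d * suc k) % suc k      ≡⟨ [m+kn]%n≡m%n (e + f i + k * suc i) (suc d) (suc k) ⟩
      (e + f i + k * suc i) % suc k                      ≡⟨ res≡ ⟩
      (e + f r + k * suc r) % suc k                      ∎))
      where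
      open ≡-Reasoning
      d = r ∸ suc i
      r≡ : suc i + d ≡ r
      r≡ = m+[n∸m]≡n i<r
      v = f i ∸ f r
      f≡ : f r + v ≡ f i
      f≡ = m+[n∸m]≡n (antitone (<⇒≤ i<r))
      v≤ : v ≤ p i
      v≤ = +-cancelˡ-≤ (f r) v (p i) (subst₂ _≤_ (sym (trans f≡ (recursion i))) (+-comm (p i) (f r))
        (+-monoʳ-≤ (p i) (antitone {r} {next i} (≤-trans r≤ (n≤1+n _)))))
      d< : d < k ∸ p i
      d< = +-cancelˡ-≤ i (suc d) (k ∸ p i) (≤-trans (≤-reflexive (trans (+-suc i d) r≡)) r≤)
      t≤ : v + d < k
      t≤ = subst (v + d <_) (k-split i) (+-mono-≤-< v≤ d<)
      regroup : ∀ k e x i d v → e + x + k * suc (suc i + d) + suc (v + d) ≡ e + (x + v) + k * suc i + suc d * suc k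
      regroup = solve-∀
      shift : e + f r + k * suc r + suc (v + d) ≡ e + f i + k * suc i + suc d * suc k
      shift = subst₂ (λ x y → e + f r + k * suc x + suc (v + d) ≡ e + y + k * suc i + suc d * suc k)
        r≡ f≡ (regroup k e (f r) i d v)

  -- By `next-first`, iterating `next` from `i` cannot jump over a row `r` of the same residue, so
  -- it arrives at `r`. The fuel bounds the remaining distance.
  runner-induction : ∀ e {P : ℕ → Set} → (∀ {i} → P i → P (next i)) →
                     ∀ {i r} → i ≤ r → residue e i ≡ residue e r → P i → P r
  runner-induction e {P} step {i} {r} = go r (m≤m+n r i)
    where
    go : ∀ fuel {i} → r ≤ fuel + i → i ≤ r → residue e i ≡ residue e r → P i → P r
    go fuel {i} r≤ i≤r res≡ Pi with m≤n⇒m<n∨m≡n i≤r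
    ... | inj₂ refl = Pi
    go zero       r≤ i≤r res≡ Pi | inj₁ i<r = contradiction r≤ (<⇒≱ i<r)
    go (suc fuel) {i} r≤ i≤r res≡ Pi | inj₁ i<r =
      go fuel (≤-trans r≤ (≤-trans (≤-reflexive (sym (+-suc fuel i))) (+-monoʳ-≤ fuel (i<next i))))
         (next-first e i<r res≡) (trans (residue-next e i) res≡) (step Pi)

  flat-runner : ∀ e {i r} → i ≤ r → residue e i ≡ residue e r → f i ≡ f (suc i) → f r ≡ f (suc r)
  flat-runner e = runner-induction e flat-next

  -- This is the failure of an addable corner in row `i`; the bottom row always has one, hence the
  -- predecessor `j`.
  FlatBelow : ℕ → Set
  FlatBelow i = ∃ λ j → i ≡ suc j × f j ≡ f (suc j)

  flatBelow-runner : ∀ e {i r} → i ≤ r → residue e i ≡ residue e r → FlatBelow i → FlatBelow r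
  flatBelow-runner e = runner-induction e λ { (j , refl , flat) → next j , next-flat flat , flat-next flat }

-- Comparison of two cores

module Pair {k f g p f' g' p'} (G : CoreRows k f g p) (D : CoreRows k f' g' p') where
  private
    module G = Rows G
    module D = Rows D

  -- If `p i < p' i`, then `D.next i < G.next i`, so by interlacing row `G.next i` of `f` is no
  -- longer than row `D.next i` of `f'`, and the two recursions give `f i < f' i`.
  strip-p≤ : (∀ i → f (suc i) ≤ f' i) → (∀ i → f' i ≤ f i) → ∀ i → p' i ≤ p i
  strip-p≤ f⁺≤f' f'≤f i = ≮⇒≥ λ p<p' → <⇒≱ (begin-strict
    f i                     ≡⟨ G.recursion i ⟩
    p i + f (G.next i)      <⟨ +-mono-<-≤ p<p' (≤-trans (G.antitone (later p<p')) (f⁺≤f' (D.next i))) ⟩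
    p' i + f' (D.next i)    ≡⟨ D.recursion i ⟨
    f' i                    ∎) (f'≤f i)
    where
    open ≤-Reasoning
    later : p i < p' i → suc (D.next i) ≤ G.next i
    later lt = s≤s (≤-trans (≤-reflexive (sym (+-suc i _))) (+-monoʳ-≤ i (∸-monoʳ-< lt (D.p≤k i))))

  -- The recursion leads from a row to a higher one, and from row `g 0 + g' 0` on both functions
  -- vanish.
  agree-above : ∀ {N} → (∀ {i} → N ≤ i → p' i ≡ p i) → ∀ {i} → N ≤ i → f' i ≡ f i
  agree-above {N} p≡ {i} = go (g 0 + g' 0) (m≤m+n _ i)
    where
    go : ∀ fuel {i} → g 0 + g' 0 ≤ fuel + i → N ≤ i → f' i ≡ f i
    go zero    L≤ N≤i = trans (D.vanishes (m+n≤o⇒n≤o (g 0) L≤)) (sym (G.vanishes (m+n≤o⇒m≤o (g 0) L≤)))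
    go (suc fuel) {i} L≤ N≤i = begin
      f' i                   ≡⟨ D.recursion i ⟩
      p' i + f' (D.next i)   ≡⟨ cong (λ x → x + f' (suc (i + (k ∸ x)))) (p≡ N≤i) ⟩
      p i + f' (G.next i)    ≡⟨ cong (p i +_) (go fuel L≤′ (≤-trans N≤i (<⇒≤ (G.i<next i)))) ⟩
      p i + f (G.next i)     ≡⟨ G.recursion i ⟨
      f i                    ∎
      where
      open ≡-Reasoning
      L≤′ : g 0 + g' 0 ≤ fuel + G.next i
      L≤′ = ≤-trans L≤ (≤-trans (≤-reflexive (sym (+-suc fuel i))) (+-monoʳ-≤ fuel (G.i<next i)))

-- Two cores whose bounded partitions differ by one box in row `r`

suc-∸-suc : ∀ {m n} → m < n → n ∸ m ≡ suc (n ∸ suc m)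
suc-∸-suc {m} {suc n} (s≤s m≤n) = +-∸-assoc 1 m≤n

module Lowered {k f g p f' g' p'} (G : CoreRows k f g p) (D : CoreRows k f' g' p')
  (r : ℕ) (p-r : p r ≡ suc (p' r)) (p-other : ∀ {i} → i ≢ r → p' i ≡ p i) where

  module G = Rows G
  module D = Rows D

  above : ∀ {i} → r < i → f' i ≡ f i
  above = Pair.agree-above G D (λ r<i → p-other (≢-sym (<⇒≢ r<i)))

  next-r : D.next r ≡ suc (G.next r)
  next-r = cong suc (trans (cong (r +_) k∸) (+-suc r _))
    where
    k∸ : k ∸ p' r ≡ suc (k ∸ p r)
    k∸ = trans (suc-∸-suc (subst (_≤ k) p-r (G.p≤k r))) (cong (λ x → suc (k ∸ x)) (sym p-r))

  f'-r : f' r ≡ p' r + f (suc (G.next r))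
  f'-r = begin
    f' r                         ≡⟨ D.recursion r ⟩
    p' r + f' (D.next r)         ≡⟨ cong (λ x → p' r + f' x) next-r ⟩
    p' r + f' (suc (G.next r))   ≡⟨ cong (p' r +_) (above (m<n⇒m<1+n (G.i<next r))) ⟩
    p' r + f (suc (G.next r))    ∎
    where open ≡-Reasoning

  -- The condition to which both corner conditions and the containment of k-conjugates reduce.
  Flat : Set
  Flat = f (G.next r) ≡ f (suc (G.next r))

  not-drop : ¬ f (suc (G.next r)) < f (G.next r) → Flat
  not-drop ≮ = ≤-antisym (≮⇒≥ ≮) (G.antitone (n≤1+n _))

  -- A drop after row `next r` would be a higher removable corner with the residue of row `r`.
  removable⇒flat : (∀ {i} → r < i → f (suc i) < f i → G.residue 0 i ≢ G.residue 0 r) → Flat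
  removable⇒flat highest = not-drop λ lt → highest (G.i<next r) lt (G.residue-next 0 r)

  -- The same drop, present in `f'` as well, is an addable corner in row `suc (G.next r)`. This row
  -- is `D.next r`, so its addable square has the residue of the one in row `r`.
  addable⇒flat : (∀ {i} → r < suc i → f' (suc i) < f' i → D.residue 1 (suc i) ≢ D.residue 1 r) → Flat
  addable⇒flat highest = not-drop λ lt →
    highest (m<n⇒m<1+n (G.i<next r)) (subst₂ _<_ (sym (above (m<n⇒m<1+n (G.i<next r)))) (sym (above (G.i<next r))) lt)
      (trans (cong (D.residue 1) (sym next-r)) (D.residue-next 1 r))

  -- If row next r were removable in f, then in column c = f (suc (next r)) the cell of row r is
  -- k-bounded in f' but not in f, while the column has the same height in both.
  conj⇒flat : ∀ {q q'} → CoreRows k g f q → CoreRows k g' f' q' → (∀ i → q' i ≤ q i) → Flat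
  conj⇒flat {q} {q'} Gc Dc q'≤q = not-drop contra
    where
    n = G.next r
    c = f (suc n)
    module Gc = CoreRows Gc
    module Dc = CoreRows Dc
    contra : ¬ c < f n
    -- Being bounded in `f'`, the cell is among the top `q' c` cells of column `c`. Since the
    -- heights are equal, it is also among the top `q c` cells, which are bounded in `f`.
    contra c<fn = <⇒≱ too-long (Gc.bounded← r<gc (subst (_≤ q c + r) g'≡g
        (≤-trans (Dc.bounded→ r<g'c short) (+-monoˡ-≤ r (q'≤q c)))))
      where
      open ≤-Reasoning
      c<f : c < f r
      c<f = <-≤-trans c<fn (G.antitone (<⇒≤ (G.i<next r)))
      g≡ : g c ≡ suc n
      g≡ = ≤-antisym (≮⇒≥ λ lt → <-irrefl refl (G.cell← lt)) (G.cell→ c<fn)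
      f'n≡ : f' n ≡ f n
      f'n≡ = above (G.i<next r)
      g'≡ : g' c ≡ suc n
      g'≡ = ≤-antisym (≮⇒≥ λ lt → <-irrefl refl (subst (c <_) (above (m<n⇒m<1+n (G.i<next r))) (D.cell← lt)))
                      (D.cell→ (subst (c <_) (sym f'n≡) c<fn))
      g'≡g : g' c ≡ g c
      g'≡g = trans g'≡ (sym g≡)
      r<gc : r < g c
      r<gc = G.cell→ c<f
      r<g'c : r < g' c
      r<g'c = subst (r <_) (sym g'≡g) r<gc
      regroup : ∀ r m p' c → suc (suc (r + m)) + (p' + c) ≡ suc p' + m + suc (c + r)
      regroup = solve-∀
      -- In `f'` the cell has hook length exactly `k`; in `f` the column is unchanged but row `r` is
      -- longer, which gives `too-long`.
      short : g' c + f' r ≤ k + suc (c + r)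
      short = ≤-reflexive (begin-equality
        g' c + f' r                      ≡⟨ cong₂ _+_ g'≡ f'-r ⟩
        suc n + (p' r + c)               ≡⟨ regroup r (k ∸ p r) (p' r) c ⟩
        suc (p' r) + (k ∸ p r) + suc (c + r) ≡⟨ cong (λ x → x + (k ∸ p r) + suc (c + r)) p-r ⟨
        p r + (k ∸ p r) + suc (c + r)    ≡⟨ cong (_+ suc (c + r)) (G.k-split r) ⟩
        k + suc (c + r)                  ∎)
      too-long : k + suc (c + r) < g c + f r
      too-long = begin
        suc (k + suc (c + r))                   ≡⟨ cong (λ x → suc (x + suc (c + r)))
                                                      (trans (cong (_+ (k ∸ p r)) (sym p-r)) (G.k-split r)) ⟨
        suc (suc (p' r) + (k ∸ p r) + suc (c + r)) ≡⟨ cong suc (regroup r (k ∸ p r) (p' r) c) ⟨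
        suc (suc n + (p' r + c))                ≡⟨ +-suc (suc n) (p' r + c) ⟨
        suc n + (suc (p' r) + c)                ≤⟨ +-monoʳ-≤ (suc n) (+-monoʳ-≤ (suc (p' r)) (<⇒≤ c<fn)) ⟩
        suc n + (suc (p' r) + f n)              ≡⟨ cong₂ (λ x y → x + (y + f n)) g≡ p-r ⟨
        g c + (p r + f n)                       ≡⟨ cong (g c +_) (G.recursion r) ⟨
        g c + f r                               ∎

  module _ (flat : Flat) where

    f-r : f r ≡ suc (f' r)
    f-r = begin
      f r                             ≡⟨ G.recursion r ⟩
      p r + f (G.next r)              ≡⟨ cong₂ _+_ p-r flat ⟩
      suc (p' r + f (suc (G.next r))) ≡⟨ cong suc f'-r ⟨
      suc (f' r)                      ∎
      where open ≡-Reasoning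

    removable : f (suc r) < f r
    removable = subst₂ _<_ (above ≤-refl) (sym f-r) (s≤s (D.antitone (n≤1+n r)))

    removable-highest : ∀ {i} → r < i → f (suc i) < f i → G.residue 0 i ≢ G.residue 0 r
    removable-highest r<i lt res≡ = <-irrefl (sym (G.flat-runner 0 (G.next-first 0 r<i (sym res≡))
      (trans (G.residue-next 0 r) (sym res≡)) flat)) lt

    -- If row `i` were as long as the next one, this would propagate up to row `r`, which is
    -- removable.
    removable-runner : ∀ {i} → i ≤ r → G.residue 0 i ≡ G.residue 0 r → f (suc i) < f i
    removable-runner i≤r res≡ = ≤∧≢⇒< (G.antitone (n≤1+n _)) λ eq →
      <-irrefl (sym (G.flat-runner 0 i≤r res≡ (sym eq))) removable

    -- Equal rows `j` and `r` of `f'` would have equal parts in `p'`, but `p' r` is one less than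
    -- `p r`, and `p r ≤ p j`.
    addable : ∀ {j} → r ≡ suc j → f' r < f' j
    addable {j} refl = ≤∧≢⇒< (D.antitone (n≤1+n j)) λ eq → <⇒≱ ≤-refl (begin
      suc (p' r)  ≡⟨ p-r ⟨
      p r         ≤⟨ G.p-antitone j ⟩
      p j         ≡⟨ p-other (<⇒≢ ≤-refl) ⟨
      p' j        ≡⟨ D.p-flat (sym eq) ⟨
      p' r        ∎)
      where open ≤-Reasoning

    -- Flatness makes rows `G.next r` and `D.next r` of `f'` equal. So row `D.next r` has no addable
    -- corner, and neither has any higher row of its residue.
    addable-highest : ∀ {i} → r < suc i → f' (suc i) < f' i → D.residue 1 (suc i) ≢ D.residue 1 r
    addable-highest {i} r<1+i lt res≡
      with D.flatBelow-runner 1 (D.next-first 1 r<1+i (sym res≡)) (trans (D.residue-next 1 r) (sym res≡))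
             (G.next r , next-r , trans (above (G.i<next r)) (trans flat (sym (above (m<n⇒m<1+n (G.i<next r))))))
    ... | .i , refl , eq = <-irrefl (sym eq) lt

    private
      Cases : ℕ → Set
      Cases i = (i ≤ r → G.residue 0 i ≡ G.residue 0 r → f i ≡ suc (f' i))
              × (r < i ⊎ G.residue 0 i ≢ G.residue 0 r → f i ≡ f' i)

      -- Below row `r` the parts agree, so `f` and `f'` differ in row `i` by as much as in row
      -- `next i`. Iterating `next` arrives at `r`, where the difference is 1, exactly for the
      -- residue of `r`; otherwise it passes to rows above `r`, where the difference is 0.
      cases : ∀ i → Cases i
      cases i = go r (m≤m+n r i)
        where
        go : ∀ fuel {i} → r ≤ fuel + i → Cases i
        go fuel {i} r≤ with <-cmp i r
        ... | tri≈ _ refl _ = (λ _ _ → f-r) , λ { (inj₁ r<r) → contradiction refl (<⇒≢ r<r) ; (inj₂ ≢) → contradiction refl ≢ }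
        ... | tri> _ _ r<i = (λ i≤r _ → contradiction r<i (≤⇒≯ i≤r)) , λ _ → sym (above r<i)
        go zero r≤ | tri< i<r _ _ = contradiction i<r (≤⇒≯ r≤)
        go (suc fuel) {i} r≤ | tri< i<r i≢r _ = lower , same
          where
          open ≡-Reasoning
          n = G.next i
          IH : Cases n
          IH = go fuel (≤-trans r≤ (≤-trans (≤-reflexive (sym (+-suc fuel i))) (+-monoʳ-≤ fuel (G.i<next i))))
          f'-i : f' i ≡ p i + f' n
          f'-i = trans (D.recursion i) (cong (λ x → x + f' (suc (i + (k ∸ x)))) (p-other i≢r))
          lower : i ≤ r → G.residue 0 i ≡ G.residue 0 r → f i ≡ suc (f' i)
          lower _ res≡ = begin
            f i               ≡⟨ G.recursion i ⟩
            p i + f n         ≡⟨ cong (p i +_) (proj₁ IH (G.next-first 0 i<r res≡) (trans (G.residue-next 0 i) res≡)) ⟩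
            p i + suc (f' n)  ≡⟨ +-suc (p i) (f' n) ⟩
            suc (p i + f' n)  ≡⟨ cong suc f'-i ⟨
            suc (f' i)        ∎
          same : r < i ⊎ G.residue 0 i ≢ G.residue 0 r → f i ≡ f' i
          same (inj₁ r<i)  = contradiction r<i (<-asym i<r)
          same (inj₂ res≢) = begin
            f i               ≡⟨ G.recursion i ⟩
            p i + f n         ≡⟨ cong (p i +_) (proj₂ IH (inj₂ λ eq → res≢ (trans (sym (G.residue-next 0 i)) eq))) ⟩
            p i + f' n        ≡⟨ f'-i ⟨
            f' i              ∎

    lowered : ∀ {i} → i ≤ r → G.residue 0 i ≡ G.residue 0 r → f i ≡ suc (f' i)
    lowered {i} = proj₁ (cases i)

    unchanged : ∀ {i} → r < i ⊎ G.residue 0 i ≢ G.residue 0 r → f i ≡ f' i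
    unchanged {i} = proj₂ (cases i)

    f-cases : ∀ i → f i ≡ f' i ⊎ f i ≡ suc (f' i)
    f-cases i with i ≤? r | G.residue 0 i ≟ G.residue 0 r
    ... | no i≰r  | _       = inj₁ (unchanged (inj₁ (≰⇒> i≰r)))
    ... | yes i≤r | yes eq  = inj₂ (lowered i≤r eq)
    ... | yes i≤r | no  neq = inj₁ (unchanged (inj₂ neq))

    -- Since each row loses at most one cell, the columns interlace: `g (suc c) ≤ g' c ≤ g c`.
    conj-p≤ : ∀ {q q'} → CoreRows k g f q → CoreRows k g' f' q' → ∀ i → q' i ≤ q i
    conj-p≤ Gc Dc = Pair.strip-p≤ Gc Dc (λ c → below λ lt → D.cell→ (s≤s⁻¹ (≤-trans (G.cell← lt) f≤)))
                                          (λ c → below λ lt → G.cell→ (<-≤-trans (D.cell← lt) f'≤))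
      where
      below : ∀ {a b} → (∀ {i} → i < a → i < b) → a ≤ b
      below h = ≮⇒≥ λ lt → <-irrefl refl (h lt)
      f≤ : ∀ {i} → f i ≤ suc (f' i)
      f≤ {i} with f-cases i
      ... | inj₁ eq = ≤-trans (≤-reflexive eq) (n≤1+n _)
      ... | inj₂ eq = ≤-reflexive eq
      f'≤ : ∀ {i} → f' i ≤ f i
      f'≤ {i} with f-cases i
      ... | inj₁ eq = ≤-reflexive (sym eq)
      ... | inj₂ eq = ≤-trans (n≤1+n _) (≤-reflexive (sym eq))

-- Counting predicates that hold on an initial or a final segment

module _ {P : ℕ → Set} (P? : Decidable P) where

  count : (ℕ → ℕ) → ℕ → ℕ
  count F m = length (filter P? (applyUpTo F m))

  count-none : ∀ F → (∀ t → ¬ P (F t)) → ∀ m → count F m ≡ 0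
  count-none F ¬P zero = refl
  count-none F ¬P (suc m) with P? (F 0)
  ... | yes p = contradiction p (¬P 0)
  ... | no _  = count-none (F ∘ suc) (¬P ∘ suc) m

  count-all : ∀ F → (∀ t → P (F t)) → ∀ m → count F m ≡ m
  count-all F all zero = refl
  count-all F all (suc m) with P? (F 0)
  ... | yes _ = cong suc (count-all (F ∘ suc) (all ∘ suc) m)
  ... | no ¬p = contradiction (all 0) ¬p

  count≤ : ∀ F m → count F m ≤ m
  count≤ F zero = z≤n
  count≤ F (suc m) with P? (F 0)
  ... | yes _ = s≤s (count≤ (F ∘ suc) m)
  ... | no _  = m≤n⇒m≤1+n (count≤ (F ∘ suc) m)

  count-prefix→ : ∀ F → (∀ t → P (F (suc t)) → P (F t)) → ∀ {m t} → t < count F m → t < m × P (F t)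
  count-prefix→ F down {suc m} {t} t< with P? (F 0)
  count-prefix→ F down {suc m} {zero}  t< | yes p = z<s , p
  count-prefix→ F down {suc m} {suc t} t< | yes p with count-prefix→ (F ∘ suc) (down ∘ suc) (s≤s⁻¹ t<)
  ... | t<m , Pt = s≤s t<m , Pt
  count-prefix→ F down {suc m} {t} t< | no ¬p =
    contradiction t< (<⇒≱ (subst (_< suc t) (sym (count-none (F ∘ suc) none m)) z<s))
    where
    none : ∀ t → ¬ P (F (suc t))
    none zero    = ¬p ∘ down 0
    none (suc t) = none t ∘ down (suc t)

  count-prefix← : ∀ F → (∀ t → P (F (suc t)) → P (F t)) → ∀ {m t} → t < m → P (F t) → t < count F m
  count-prefix← F down {suc m} {t} t<m Pt with P? (F 0)
  count-prefix← F down {suc m} {zero}  t<m Pt | yes p = z<s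
  count-prefix← F down {suc m} {suc t} t<m Pt | yes p = s≤s (count-prefix← (F ∘ suc) (down ∘ suc) (s≤s⁻¹ t<m) Pt)
  ... | no ¬p = contradiction (descend t Pt) ¬p
    where
    descend : ∀ t → P (F t) → P (F 0)
    descend zero    = λ p → p
    descend (suc t) = descend t ∘ down t

  -- The inequality places position `t` among the last `count F m` of `m` positions, as required for
  -- the bounded cells of a row.
  count-suffix→ : ∀ F → (∀ t → P (F t) → P (F (suc t))) → ∀ {m t} → P (F t) → m ≤ count F m + t
  count-suffix→ F up {zero} Pt = z≤n
  count-suffix→ F up {suc m} {t} Pt with P? (F 0)
  ... | yes p = s≤s (subst (λ x → m ≤ x + t) (sym (count-all (F ∘ suc) all m)) (m≤m+n m t))
    where
    all : ∀ t → P (F (suc t))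
    all zero    = up 0 p
    all (suc t) = up (suc t) (all t)
  count-suffix→ F up {suc m} {zero}  Pt | no ¬p = contradiction Pt ¬p
  count-suffix→ F up {suc m} {suc t} Pt | no ¬p =
    ≤-trans (s≤s (count-suffix→ (F ∘ suc) (up ∘ suc) Pt)) (≤-reflexive (sym (+-suc _ t)))

  count-suffix← : ∀ F → (∀ t → P (F t) → P (F (suc t))) → ∀ {m t} → t < m → m ≤ count F m + t → P (F t)
  count-suffix← F up {suc m} {t} t<m m≤ with P? (F 0)
  ... | yes p = all t
    where
    all : ∀ t → P (F t)
    all zero    = p
    all (suc t) = up t (all t)
  count-suffix← F up {suc m} {zero}  t<m m≤ | no ¬p =
    contradiction (≤-trans m≤ (≤-trans (≤-reflexive (+-identityʳ _)) (count≤ (F ∘ suc) m))) 1+n≰n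
  count-suffix← F up {suc m} {suc t} t<m m≤ | no ¬p =
    count-suffix← (F ∘ suc) (up ∘ suc) (s≤s⁻¹ t<m) (s≤s⁻¹ (≤-trans m≤ (≤-reflexive (+-suc _ t))))

-- From lists to row functions: conjugates, hooks and cores

at-applyUpTo : ∀ (F : ℕ → ℕ) {n i} → i < n → at (applyUpTo F n) i ≡ F i
at-applyUpTo F {suc n} {zero}  i<n = refl
at-applyUpTo F {suc n} {suc i} i<n = at-applyUpTo (F ∘ suc) (s≤s⁻¹ i<n)

at-applyUpTo-beyond : ∀ (F : ℕ → ℕ) {n i} → n ≤ i → at (applyUpTo F n) i ≡ 0
at-applyUpTo-beyond F {zero}          n≤i = refl
at-applyUpTo-beyond F {suc n} {suc i} n≤i = at-applyUpTo-beyond (F ∘ suc) (s≤s⁻¹ n≤i)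

map-from : ∀ (h : ℕ → ℕ) n → map h (from 0 count n) ≡ applyUpTo (h ∘ suc) n
map-from h n = trans (cong (map h) (map-upTo suc n)) (map-applyUpTo suc h n)

at<⇒<length : ∀ γ {i c} → c < at γ i → i < length γ
at<⇒<length (x ∷ γ) {zero}  c< = z<s
at<⇒<length (x ∷ γ) {suc i} c< = s≤s (at<⇒<length γ c<)

at-beyond : ∀ γ {i} → length γ ≤ i → at γ i ≡ 0
at-beyond γ len≤i = n≤0⇒n≡0 (≮⇒≥ λ 0<at → <⇒≱ (at<⇒<length γ 0<at) len≤i)

at-step : ∀ {γ} → IsPartition γ → ∀ i → at γ (suc i) ≤ at γ i
at-step nil         i       = z≤n
at-step (one _)     i       = z≤n
at-step (cons y≤x _)  zero    = y≤x
at-step (cons _ part) (suc i) = at-step part i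

at-antitone : ∀ {γ} → IsPartition γ → ∀ {i j} → i ≤ j → at γ j ≤ at γ i
at-antitone part {i} {zero}  z≤n = ≤-refl
at-antitone part {i} {suc j} i≤j with m≤n⇒m<n∨m≡n i≤j
... | inj₁ i<j = ≤-trans (at-step part j) (at-antitone part (s≤s⁻¹ i<j))
... | inj₂ refl = ≤-refl

<-ext : ∀ {a b} → (∀ {t} → t < a → t < b) → (∀ {t} → t < b → t < a) → a ≡ b
<-ext a→b b→a = ≤-antisym (≮⇒≥ λ lt → <-irrefl refl (a→b lt)) (≮⇒≥ λ lt → <-irrefl refl (b→a lt))

module _ {γ} (part : IsPartition γ) where

  private
    down : ∀ c t → suc c ≤ at γ (suc t) → suc c ≤ at γ t
    down c t lt = ≤-trans lt (at-step part t)

    at-conj : ∀ {c} → c < at γ 0 → at (conj γ) c ≡ count (λ i → suc c ≤? row γ i) suc (length γ)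
    at-conj {c} c< = trans (cong (λ xs → at xs c) (map-from _ (at γ 0)))
      (trans (at-applyUpTo _ c<) (cong (λ xs → length (filter (λ i → suc c ≤? row γ i) xs)) (map-upTo suc (length γ))))

  conj-cell→ : ∀ {i c} → c < at γ i → i < at (conj γ) c
  conj-cell→ {i} {c} c< = subst (i <_) (sym (at-conj (≤-trans c< (at-antitone part z≤n))))
    (count-prefix← _ suc (down c) (at<⇒<length γ c<) c<)

  conj-cell← : ∀ {i c} → i < at (conj γ) c → c < at γ i
  conj-cell← {i} {c} i< with c <? at γ 0
  ... | yes c< = proj₂ (count-prefix→ _ suc (down c) {length γ} (subst (i <_) (at-conj c<) i<))
  ... | no c≮ = contradiction (subst (i <_) beyond i<) n≮0
    where
    beyond : at (conj γ) c ≡ 0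
    beyond = trans (cong (λ xs → at xs c) (map-from _ (at γ 0))) (at-applyUpTo-beyond _ (≮⇒≥ c≮))

module _ (γ : List ℕ) (g : ℕ → ℕ) (cell→ : ∀ {i c} → c < at γ i → i < g c)
         (cell← : ∀ {i c} → i < g c → c < at γ i) where

  leg≡ : ∀ i c → leg γ (suc i) (suc c) ≡ g c ∸ suc i
  leg≡ i c = trans (cong (λ xs → length (filter _ xs)) (map-upTo (λ t → suc (suc i + t)) (length γ ∸ suc i)))
    (<-ext to from)
    where
    P? : Decidable (λ i' → suc c ≤ row γ i')
    P? i' = suc c ≤? row γ i'
    F = λ t → suc (suc i + t)
    down : ∀ t → suc c ≤ row γ (F (suc t)) → suc c ≤ row γ (F t)
    down t lt = cell← (≤-trans (s≤s (+-monoʳ-≤ (suc i) (n≤1+n t))) (cell→ lt))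
    to : ∀ {t} → t < count P? F (length γ ∸ suc i) → t < g c ∸ suc i
    to {t} lt = m+n≤o⇒m≤o∸n (suc t) (≤-trans (≤-reflexive (cong suc (+-comm t (suc i))))
      (cell→ (proj₂ (count-prefix→ P? F down {length γ ∸ suc i} lt))))
    from : ∀ {t} → t < g c ∸ suc i → t < count P? F (length γ ∸ suc i)
    from {t} lt = count-prefix← P? F down
      (m+n≤o⇒m≤o∸n (suc t) (≤-trans (≤-reflexive (cong suc (+-comm t (suc i)))) (at<⇒<length γ cell))) cell
      where
      cell : c < at γ (suc i + t)
      cell = cell← (≤-trans (≤-reflexive (cong suc (+-comm (suc i) t)))
        (m≤o∸n⇒m+n≤o (suc t) (<⇒≤ (m∸n≢0⇒n<m (≢-sym (<⇒≢ (m<n⇒0<n lt))))) lt))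

  hook≡ : ∀ i c → hook γ (suc i) (suc c) ≡ (at γ i ∸ suc c + 1) + (g c ∸ suc i)
  hook≡ i c = cong (at γ i ∸ suc c + 1 +_) (leg≡ i c)

  -- This brings the hook length, defined by truncated subtraction, into the form used in
  -- `CoreRows`.
  hook-cell : ∀ {i c} → c < at γ i → hook γ (suc i) (suc c) + suc (i + c) ≡ at γ i + g c
  hook-cell {i} {c} c< = begin
    hook γ (suc i) (suc c) + suc (i + c)                          ≡⟨ cong (_+ suc (i + c)) (hook≡ i c) ⟩
    at γ i ∸ suc c + 1 + (g c ∸ suc i) + suc (i + c)              ≡⟨ regroup (at γ i ∸ suc c) (g c ∸ suc i) i c ⟩
    (at γ i ∸ suc c + suc c) + (g c ∸ suc i + suc i)              ≡⟨ cong₂ _+_ (m∸n+n≡m c<) (m∸n+n≡m (cell→ c<)) ⟩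
    at γ i + g c                                                  ∎
    where
    open ≡-Reasoning
    regroup : ∀ a b i c → a + 1 + b + suc (i + c) ≡ (a + suc c) + (b + suc i)
    regroup = solve-∀

  -- This makes the `k`-bounded cells of a row a final segment. Squares beyond the row are included
  -- because the lemmas on final segments quantify over all positions.
  hook-step : ∀ i c → hook γ (suc i) (suc (suc c)) ≤ hook γ (suc i) (suc c)
  hook-step i c = subst₂ _≤_ (sym (hook≡ i (suc c))) (sym (hook≡ i c))
    (+-mono-≤ (+-monoˡ-≤ 1 (∸-monoʳ-≤ (at γ i) (n≤1+n (suc c)))) (∸-monoˡ-≤ (suc i) g-step))
    where
    g-step : g (suc c) ≤ g c
    g-step = ≮⇒≥ λ lt → <-irrefl refl (cell→ (<⇒≤ (cell← lt)))

  at-𝔭 : ∀ k i → at (𝔭 k γ) i ≡ count (λ j → hook γ (suc i) j ≤? k) suc (at γ i)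
  at-𝔭 k i with i <? length γ
  ... | yes i< = trans (cong (λ xs → at xs i) (map-from _ (length γ))) (trans (at-applyUpTo _ i<)
          (cong (λ xs → length (filter (λ j → hook γ (suc i) j ≤? k) xs)) (map-upTo suc (at γ i))))
  ... | no i≮ = trans (cong (λ xs → at xs i) (map-from _ (length γ))) (trans (at-applyUpTo-beyond _ (≮⇒≥ i≮))
          (cong (count (λ j → hook γ (suc i) j ≤? k) suc) (sym (at-beyond γ (≮⇒≥ i≮)))))

  coreRows : ∀ k → (∀ {i c} → c < at γ i → at γ i + g c ≢ suc k + suc (i + c)) → CoreRows k (at γ) g (at (𝔭 k γ))
  coreRows k noHook = record
    { cell→    = cell→
    ; cell←    = cell←
    ; noHook   = noHook
    ; bounded→ = λ {i} {c} c< le → subst (λ x → at γ i ≤ x + c) (sym (at-𝔭 k i))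
        (count-suffix→ (λ j → hook γ (suc i) j ≤? k) suc (up i)
          (+-cancelʳ-≤ (suc (i + c)) _ k (≤-trans (≤-reflexive (hook-cell c<)) le)))
    ; bounded← = λ {i} {c} c< le → ≤-trans (≤-reflexive (sym (hook-cell c<))) (+-monoˡ-≤ (suc (i + c))
        (count-suffix← (λ j → hook γ (suc i) j ≤? k) suc (up i) c< (subst (λ x → at γ i ≤ x + c) (at-𝔭 k i) le)))
    ; p≤f      = λ i → subst (_≤ at γ i) (sym (at-𝔭 k i)) (count≤ (λ j → hook γ (suc i) j ≤? k) suc (at γ i))
    }
    where
    up : ∀ i t → hook γ (suc i) (suc t) ≤ k → hook γ (suc i) (suc (suc t)) ≤ k
    up i t = ≤-trans (hook-step i t)

module _ {k γ} (core : IsCore k γ) where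

  private
    part = proj₁ core

    noHook : ∀ {i c} → c < at γ i → at γ i + at (conj γ) c ≢ suc k + suc (i + c)
    noHook {i} {c} c< eq = proj₂ core (suc i) (suc c) (s≤s z≤n , s≤s z≤n , c<)
      (+-cancelʳ-≡ (suc (i + c)) _ _ (trans (hook-cell γ (at (conj γ)) (conj-cell→ part) (conj-cell← part) c<) eq))

  core-rows : CoreRows k (at γ) (at (conj γ)) (at (𝔭 k γ))
  core-rows = coreRows γ (at (conj γ)) (conj-cell→ part) (conj-cell← part) k noHook

  -- Exchanging rows and columns exchanges the two summands of the hook equation, so `noHook` for
  -- `γ` also serves its conjugate.
  core-cols : CoreRows k (at (conj γ)) (at γ) (at (kconj k γ))
  core-cols = coreRows (conj γ) (at γ) (conj-cell← part) (conj-cell→ part) k λ {c} {i} i< eq →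
    noHook (conj-cell← part i<) (trans (+-comm (at γ i) _) (trans eq (cong (λ x → suc k + suc x) (+-comm c i))))

-- Sizes of partitions and a single extra box

sumTo : (ℕ → ℕ) → ℕ → ℕ
sumTo a zero    = 0
sumTo a (suc n) = a 0 + sumTo (a ∘ suc) n

-- Any `n` from the length on is allowed, so that lists of different lengths can be summed over one
-- range.
sum-at : ∀ xs {n} → length xs ≤ n → sum xs ≡ sumTo (at xs) n
sum-at []       {zero}  _       = refl
sum-at []       {suc n} _       = sum-at [] {n} z≤n
sum-at (x ∷ xs) {suc n} (s≤s h) = cong (x +_) (sum-at xs h)

sumTo-mono : ∀ {a b} → (∀ i → a i ≤ b i) → ∀ n → sumTo a n ≤ sumTo b n
sumTo-mono a≤b zero    = z≤n
sumTo-mono a≤b (suc n) = +-mono-≤ (a≤b 0) (sumTo-mono (a≤b ∘ suc) n)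

sumTo-cancel : ∀ {a b} → (∀ i → a i ≤ b i) → ∀ n → sumTo b n ≤ sumTo a n → ∀ {i} → i < n → a i ≡ b i
sumTo-cancel {a} {b} a≤b (suc n) le {zero} _ = ≤-antisym (a≤b 0) (≮⇒≥ λ lt →
  <⇒≱ (+-mono-<-≤ lt (sumTo-mono (a≤b ∘ suc) n)) le)
sumTo-cancel {a} {b} a≤b (suc n) le {suc i} i<n = sumTo-cancel (a≤b ∘ suc) n
  (≮⇒≥ λ lt → <⇒≱ (+-mono-≤-< (a≤b 0) lt) le) (s≤s⁻¹ i<n)

-- If the first entries agree, the surplus lies in the tail; otherwise the first entry uses it up
-- and the tails agree.
sumTo-extra→ : ∀ {a b} → (∀ i → a i ≤ b i) → ∀ n → sumTo b n ≡ suc (sumTo a n) →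
               ∃ λ r → r < n × (∀ {i} → i < n → a i + δ i r ≡ b i)
sumTo-extra→ {a} {b} a≤b (suc n) eq with m≤n⇒m<n∨m≡n (a≤b 0)
... | inj₂ a₀≡b₀ = suc r , s≤s r<n , entry
  where
  tail : sumTo (b ∘ suc) n ≡ suc (sumTo (a ∘ suc) n)
  tail = +-cancelˡ-≡ (b 0) _ _ (trans eq (trans (sym (+-suc (a 0) _)) (cong (_+ suc (sumTo (a ∘ suc) n)) a₀≡b₀)))
  rest = sumTo-extra→ (a≤b ∘ suc) n tail
  r = proj₁ rest
  r<n = proj₁ (proj₂ rest)
  h = proj₂ (proj₂ rest)
  entry : ∀ {i} → i < suc n → a i + δ i (suc r) ≡ b i
  entry {zero}  _  = trans (+-identityʳ _) a₀≡b₀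
  entry {suc i} lt = h (s≤s⁻¹ lt)
... | inj₁ a₀<b₀ = 0 , z<s , entry
  where
  tail≤ : sumTo (b ∘ suc) n ≤ sumTo (a ∘ suc) n
  tail≤ = ≮⇒≥ λ lt → <-irrefl (sym eq) (+-mono-≤-< a₀<b₀ lt)
  b₀≡ : b 0 ≡ suc (a 0)
  b₀≡ = ≤-antisym (+-cancelʳ-≤ (sumTo (a ∘ suc) n) (b 0) (suc (a 0))
    (≤-trans (+-monoʳ-≤ (b 0) (sumTo-mono (a≤b ∘ suc) n)) (≤-reflexive eq))) a₀<b₀
  entry : ∀ {i} → i < suc n → a i + δ i 0 ≡ b i
  entry {zero}  _  = trans (+-comm (a 0) 1) (sym b₀≡)
  entry {suc i} lt = trans (+-identityʳ _) (sumTo-cancel (a≤b ∘ suc) n tail≤ (s≤s⁻¹ lt))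

sumTo-cong : ∀ {a b} → (∀ i → a i ≡ b i) → ∀ n → sumTo a n ≡ sumTo b n
sumTo-cong a≡b zero    = refl
sumTo-cong a≡b (suc n) = cong₂ _+_ (a≡b 0) (sumTo-cong (a≡b ∘ suc) n)

sumTo-extra← : ∀ {a b} r n → r < n → (∀ i → a i + δ i r ≡ b i) → sumTo b n ≡ suc (sumTo a n)
sumTo-extra← {a} {b} zero    (suc n) _   h = cong₂ _+_ (trans (sym (h 0)) (+-comm (a 0) 1))
  (sumTo-cong (λ i → trans (sym (h (suc i))) (+-identityʳ _)) n)
sumTo-extra← {a} {b} (suc r) (suc n) r<n h = trans
  (cong₂ _+_ (trans (sym (h 0)) (+-identityʳ _)) (sumTo-extra← r n (s≤s⁻¹ r<n) (h ∘ suc))) (+-suc (a 0) _)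

δ-diag : ∀ r → δ r r ≡ 1
δ-diag zero    = refl
δ-diag (suc r) = δ-diag r

δ-off : ∀ {i r} → i ≢ r → δ i r ≡ 0
δ-off {zero}  {zero}  ≢ = contradiction refl ≢
δ-off {zero}  {suc r} ≢ = refl
δ-off {suc i} {zero}  ≢ = refl
δ-off {suc i} {suc r} ≢ = δ-off (≢ ∘ cong suc)

module _ (xs ys : List ℕ) where

  private
    N = length xs + length ys
    xs-N : sum xs ≡ sumTo (at xs) N
    xs-N = sum-at xs (m≤m+n _ _)
    ys-N : sum ys ≡ sumTo (at ys) N
    ys-N = sum-at ys (m≤n+m _ (length xs))

  extra-box→ : xs ⊆ ys → ∣ ys ∣ ≡ suc ∣ xs ∣ → ∃ λ r → xs ≐ ys -e suc r
  extra-box→ xs⊆ys eq with sumTo-extra→ (xs⊆ys ∘ suc) N (trans (sym ys-N) (trans eq (cong suc xs-N)))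
  ... | r , r<N , h = r , λ { zero → refl ; (suc i) → box i }
    where
    box : ∀ i → at xs i + δ i r ≡ at ys i
    box i with i <? N
    ... | yes i<N = h i<N
    ... | no  i≮N = trans (cong₂ _+_ (at-beyond xs (≤-trans (m≤m+n _ _) (≮⇒≥ i≮N))) (δ-off {i} {r} (λ { refl → i≮N r<N })))
                          (sym (at-beyond ys (≤-trans (m≤n+m _ (length xs)) (≮⇒≥ i≮N))))

  extra-box← : ∀ {r} → xs ≐ ys -e r → ∣ ys ∣ ≡ suc ∣ xs ∣
  -- Row 0 has length 0 in both lists, while `δ 0 0` is 1.
  extra-box← {zero}  h = contradiction (h 0) λ ()
  extra-box← {suc r} h = trans ys-N (trans (sumTo-extra← r N r<N (h ∘ suc)) (cong suc (sym xs-N)))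
    where
    r<N : r < N
    r<N = ≤-trans (at<⇒<length ys (subst (0 <_) (h (suc r))
      (subst (λ x → 0 < at xs r + x) (sym (δ-diag r)) (m≤n+m 1 _)))) (m≤n+m _ (length xs))

-- The operator `s` on removable corners

remI→ : ∀ {k ρ γ r} → T (remI k ρ γ (suc r)) → at γ (suc r) < at γ r × remRes k γ (suc r) ≡ ρ
remI→ {k} {ρ} {γ} {r} t with Equivalence.to (T-∧ {remB γ (suc r)}) t
... | rem , res = ≤ᵇ⇒≤ _ _ (proj₂ (Equivalence.to (T-∧ {1 ≤ᵇ at γ r}) rem)) , ≡ᵇ⇒≡ _ _ res

remI← : ∀ {k ρ γ r} → at γ (suc r) < at γ r → remRes k γ (suc r) ≡ ρ → T (remI k ρ γ (suc r))
remI← {k} {ρ} {γ} {r} lt res = Equivalence.from T-∧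
  (Equivalence.from T-∧ (≤⇒≤ᵇ (≤-trans (s≤s z≤n) lt) , ≤⇒≤ᵇ lt) , ≡⇒≡ᵇ _ _ res)

any-applyUpTo : ∀ (b : ℕ → Bool) (F : ℕ → ℕ) {n i} → i < n → T (b (F i)) → any b (applyUpTo F n) ≡ true
any-applyUpTo b F {suc n} {i} i<n t with b (F 0) in eq
... | true = refl
any-applyUpTo b F {suc n} {zero}  i<n t | false = contradiction (subst T eq t) λ ()
any-applyUpTo b F {suc n} {suc i} i<n t | false = any-applyUpTo b (F ∘ suc) (s≤s⁻¹ i<n) t

-- The given removable corner selects the first branch of `s`; beyond the list both sides are 0.
at-s : ∀ k ρ γ {r} → T (remI k ρ γ (suc r)) → ∀ i →
       at (s k ρ γ) i ≡ (if remI k ρ γ (suc i) then at γ i ∸ 1 else at γ i)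
at-s k ρ γ {r} t i with any (remI k ρ γ) (rows γ) in eq
... | false = contradiction (trans (sym eq) found) λ ()
  where
  found : any (remI k ρ γ) (rows γ) ≡ true
  found = trans (cong (any (remI k ρ γ)) (map-upTo suc (length γ)))
    (any-applyUpTo (remI k ρ γ) suc (at<⇒<length γ (proj₁ (remI→ {k} {ρ} {γ} {r} t))) t)
... | true with i <? length γ
...   | yes i< = trans (cong (λ xs → at xs i) (map-from _ (length γ))) (at-applyUpTo _ i<)
...   | no i≮ = trans (cong (λ xs → at xs i) (map-from _ (length γ))) (trans (at-applyUpTo-beyond _ (≮⇒≥ i≮)) (sym none))
  where
  at≡0 : at γ i ≡ 0
  at≡0 = at-beyond γ (≮⇒≥ i≮)
  none : (if remI k ρ γ (suc i) then at γ i ∸ 1 else at γ i) ≡ 0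
  none with remI k ρ γ (suc i)
  ... | true  = cong (_∸ 1) at≡0
  ... | false = at≡0

-- Corners of the cores and the equivalences

module OneBox {k δ' γ} (coreδ : IsCore k δ') (coreγ : IsCore k γ) (r : ℕ) (box : 𝔭 k δ' ≐ 𝔭 k γ -e suc r) where

  private
    p-r : at (𝔭 k γ) r ≡ suc (at (𝔭 k δ') r)
    p-r = trans (sym (box (suc r))) (trans (cong (at (𝔭 k δ') r +_) (δ-diag r)) (+-comm _ 1))

    p-other : ∀ {i} → i ≢ r → at (𝔭 k δ') i ≡ at (𝔭 k γ) i
    p-other {i} i≢r = trans (sym (+-identityʳ _)) (trans (cong (at (𝔭 k δ') i +_) (sym (δ-off i≢r))) (box (suc i)))

  -- Row `suc r` of a partition has index `r` in `Lowered`. With this shift `remRes` for `γ` and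
  -- `addRes` for `δ'` compute to `G.residue 0` and `D.residue 1`.
  open Lowered (core-rows coreγ) (core-rows coreδ) r p-r p-other public

  HighestRemovable : Set
  HighestRemovable = ∀ r' → suc r < r' → RemCorner γ r' → remRes k γ r' ≢ remRes k γ (suc r)

  HighestAddable : Set
  HighestAddable = ∀ r' → suc r < r' → AddCorner δ' r' → addRes k δ' r' ≢ addRes k δ' (suc r)

  arrow⇒flat : Arrow k δ' γ → Flat
  arrow⇒flat (_ , _ , conj⊆) = conj⇒flat (core-cols coreγ) (core-cols coreδ) (conj⊆ ∘ suc)

  flat⇒arrow : Flat → Arrow k δ' γ
  flat⇒arrow flat = extra-box← (𝔭 k δ') (𝔭 k γ) box
    , (λ i → ≤-trans (m≤m+n _ _) (≤-reflexive (box i)))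
    , λ { zero → z≤n ; (suc c) → conj-p≤ flat (core-cols coreγ) (core-cols coreδ) c }

  highestRemovable⇒flat : HighestRemovable → Flat
  highestRemovable⇒flat highest = removable⇒flat λ {i} r<i lt →
    highest (suc i) (s≤s r<i) (s≤s z≤n , ≤-trans (s≤s z≤n) lt , lt)

  flat⇒removable : Flat → RemCorner γ (suc r) × HighestRemovable
  flat⇒removable flat = (s≤s z≤n , ≤-trans (s≤s z≤n) (removable flat) , removable flat) , highest
    where
    highest : HighestRemovable
    highest (suc i) r<r' (_ , _ , lt) = removable-highest flat (s≤s⁻¹ r<r') lt

  highestAddable⇒flat : HighestAddable → Flat
  highestAddable⇒flat highest = addable⇒flat λ {i} r<i lt →
    highest (suc (suc i)) (s≤s r<i) (s≤s z≤n , inj₂ lt)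

  flat⇒addable : Flat → AddCorner δ' (suc r) × HighestAddable
  flat⇒addable flat = (s≤s z≤n , corner r refl) , highest
    where
    corner : ∀ x → r ≡ x → suc x ≡ 1 ⊎ suc (row δ' (suc x)) ≤ row δ' x
    corner zero    _  = inj₁ refl
    corner (suc j) refl = inj₂ (addable flat refl)
    highest : HighestAddable
    highest (suc zero)    (s≤s ())
    highest (suc (suc i)) r<r' (_ , inj₂ lt) = addable-highest flat (s≤s⁻¹ r<r') lt

  -- The rows of `γ` with a removable corner of this residue are those of the residue up to `r`,
  -- which are exactly the rows that are one cell shorter in `δ'`.
  flat⇒s : Flat → s k (remRes k γ (suc r)) γ ≅ δ'
  flat⇒s flat zero    = refl
  flat⇒s flat (suc i) = trans (at-s k ρ γ {r} (remI← {k} {ρ} {γ} {r} (removable flat) refl) i) entry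
    where
    ρ = remRes k γ (suc r)
    entry : (if remI k ρ γ (suc i) then at γ i ∸ 1 else at γ i) ≡ at δ' i
    entry with remI k ρ γ (suc i) in eq
    ... | true with remI→ {k} {ρ} {γ} {i} (subst T (sym eq) _)
    ...   | lt , res = cong (_∸ 1) (lowered flat (≮⇒≥ λ r<i → removable-highest flat r<i lt res) res)
    entry | false = unchanged flat outside
      where
      outside : r < i ⊎ G.residue 0 i ≢ G.residue 0 r
      outside with i ≤? r
      ... | no  i≰r = inj₁ (≰⇒> i≰r)
      ... | yes i≤r = inj₂ λ res → subst T eq (remI← {k} {ρ} {γ} {i} (removable-runner flat i≤r res) res)

theorem23 : (k : ℕ) → 1 ≤ k → (δ' γ : List ℕ) → IsCore k δ' → IsCore k γ →
    ((Arrow k δ' γ ⇔ ∃ λ r → (𝔭 k δ' ≐ 𝔭 k γ -e r) × RemCorner γ r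
    × (∀ r' → r < r' → RemCorner γ r' → remRes k γ r' ≢ remRes k γ r))
    × (∀ r → (𝔭 k δ' ≐ 𝔭 k γ -e r) → RemCorner γ r
    → (∀ r' → r < r' → RemCorner γ r' → remRes k γ r' ≢ remRes k γ r)
    → s k (remRes k γ r) γ ≅ δ')
    × (Arrow k δ' γ ⇔ ∃ λ r → (𝔭 k γ ≐ 𝔭 k δ' +e r) × AddCorner δ' r
    × (∀ r' → r < r' → AddCorner δ' r' → addRes k δ' r' ≢ addRes k δ' r)))
theorem23 k _ δ' γ coreδ coreγ = mk⇔ arrow→rem rem→arrow , rem→s , mk⇔ arrow→add add→arrow
  where
  module Box r box = OneBox coreδ coreγ r box

  box-of : Arrow k δ' γ → ∃ λ r → 𝔭 k δ' ≐ 𝔭 k γ -e suc r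
  box-of (size , p⊆ , _) = extra-box→ (𝔭 k δ') (𝔭 k γ) p⊆ size

  arrow→rem : Arrow k δ' γ → _
  arrow→rem arrow with box-of arrow
  ... | r , box = suc r , box , Box.flat⇒removable r box (Box.arrow⇒flat r box arrow)

  rem→arrow : (∃ λ r → (𝔭 k δ' ≐ 𝔭 k γ -e r) × RemCorner γ r × _) → Arrow k δ' γ
  -- Row 0 is ruled out by `1 ≤ r` in `RemCorner`.
  rem→arrow (suc r , box , _ , highest) = Box.flat⇒arrow r box (Box.highestRemovable⇒flat r box highest)

  rem→s : ∀ r → (𝔭 k δ' ≐ 𝔭 k γ -e r) → RemCorner γ r
    → (∀ r' → r < r' → RemCorner γ r' → remRes k γ r' ≢ remRes k γ r) → s k (remRes k γ r) γ ≅ δ'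
  rem→s (suc r) box _ highest = Box.flat⇒s r box (Box.highestRemovable⇒flat r box highest)

  arrow→add : Arrow k δ' γ → _
  arrow→add arrow with box-of arrow
  ... | r , box = suc r , sym ∘ box , Box.flat⇒addable r box (Box.arrow⇒flat r box arrow)

  add→arrow : (∃ λ r → (𝔭 k γ ≐ 𝔭 k δ' +e r) × AddCorner δ' r × _) → Arrow k δ' γ
  add→arrow (suc r , box , _ , highest) =
    Box.flat⇒arrow r (sym ∘ box) (Box.highestAddable⇒flat r (sym ∘ box) highest)
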